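{- Let $(S,\cdot)$ be a commutative semigroup with identity. Then $(\beta S,\leq_{\mathcal{F}_{(S,\cdot)}})$ is upward directed, i.e. for all $\mathcal{U},\mathcal{V}\in\beta S$ there is $\mathcal{W}\in\beta S$ with $\mathcal{U}\leq_{\mathcal{F}_{(S,\cdot)}}\mathcal{W}$ and $\mathcal{V}\leq_{\mathcal{F}_{(S,\cdot)}}\mathcal{W}$. In particular $M(\beta S,\mathcal{F}_{(S,\cdot)})\neq\emptyset$.
   Context: $\mathcal{F}_{(S,\cdot)}$ is the family of all functions $f_r:S\to S$, $f_r(s)=s\cdot r$, for $r\in S$. For $A,B\subseteq S$ and a family $\mathcal{F}$ of functions $S\to S$, $A\leq_{\mathcal{F}}B$ means that for every finite $F\subseteq A$ there is $f\in\mathcal{F}$ with $f(F)\subseteq B$. For $\mathcal{U},\mathcal{V}\in\beta S$, $\mathcal{U}\leq_{\mathcal{F}}\mathcal{V}$ means that for every $B\in\mathcal{V}$ there is $A\in\mathcal{U}$ with $A\leq_{\mathcal{F}}B$. $M(\beta S,\mathcal{F})$ is the set of $\mathcal{U}\in\beta S$ such that $\mathcal{V}\leq_{\mathcal{F}}\mathcal{U}$ for every $\mathcal{V}\in\beta S$. -}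

module Defs where

open import Data.List.Base using (List)
open import Data.List.Relation.Unary.All using (All)
open import Data.Product.Base using (_×_; ∃-syntax)
open import Data.Sum.Base using (_⊎_)
open import Level using (Level; suc)
open import Relation.Unary using (Pred; _∈_; _⊆_; _∩_; ∁; Satisfiable)
open import Relation.Unary.Polymorphic using (U)

private
  variable
    ℓ : Level
    S I : Set ℓ

-- Subsets of S are predicates `Pred S ℓ`, at the level of S itself.
record Ultrafilter {ℓ} (S : Set ℓ) : Set (suc ℓ) where
  field
    Member   : Pred (Pred S ℓ) ℓ
    whole    : U ∈ Member
    upward   : ∀ {A B} → A ⊆ B → A ∈ Member → B ∈ Member
    ∩-closed : ∀ {A B} → A ∈ Member → B ∈ Member → (A ∩ B) ∈ Member
    -- Given `upward`, this is the positive form of ∅ ∉ Member.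
    proper   : ∀ {A} → A ∈ Member → Satisfiable A
    ultra    : ∀ A → A ∈ Member ⊎ ∁ A ∈ Member

open Ultrafilter public using (Member)

β : Set ℓ → Set (suc ℓ)
β S = Ultrafilter S

-- A family of functions S → S, presented by an index set I.
Family : Set ℓ → Set ℓ → Set ℓ
Family I S = I → S → S

-- The family 𝓕_(S,·) of the functions f_r(s) = s · r, for r in S.
𝓕 : (S → S → S) → Family S S
𝓕 _∙_ r s = s ∙ r

-- Finite subsets F of A are given by lists, possibly with repetitions.
SubsetLe : {S I : Set ℓ} → Family I S → Pred S ℓ → Pred S ℓ → Set ℓ
SubsetLe {S = S} f A B =
  (F : List S) → All (_∈ A) F → ∃[ i ] All (λ s → f i s ∈ B) F

UltrafilterLe : {S I : Set ℓ} → Family I S → β S → β S → Set (suc ℓ)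
UltrafilterLe f 𝒰 𝒱 =
  ∀ B → B ∈ Member 𝒱 → ∃[ A ] (A ∈ Member 𝒰 × SubsetLe f A B)

syntax SubsetLe f A B = A ≤[ f ] B
syntax UltrafilterLe f 𝒰 𝒱 = 𝒰 ≤β[ f ] 𝒱

M : {S I : Set ℓ} → Family I S → Pred (β S) (suc ℓ)
M f 𝒰 = ∀ 𝒱 → 𝒱 ≤β[ f ] 𝒰

{-# OPTIONS --safe #-}

-- The product 𝒰 · 𝒱 is an upper bound of 𝒰 and 𝒱.  For the second part, call B large if
-- every 𝒱 has a member A ≤ B.  Directedness makes largeness partition regular: if B ∪ C is large
-- but 𝒰 and 𝒱 witness that B and C are not, then 𝒰 · 𝒱 has a member A ≤ B ∪ C; an ultrafilter
-- containing { r ∣ s · r ∈ B ∪ C } for all s ∈ A splits A into a part below B and a part below C,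
-- one of which belongs to 𝒰 · 𝒱, a contradiction.  Hence the complements of the sets that are
-- not large extend to an ultrafilter, and it lies in M.
--
-- Excluded middle for arbitrary types picks elements of inhabited types, so it yields choice;
-- the ultrafilter lemma is obtained from it through the Teichmüller–Tukey lemma.

module Submission where

open import Defs
open import Algebra.Structures using (IsCommutativeMonoid)
open import Axiom.ExcludedMiddle using (ExcludedMiddle)
open import Axiom.Extensionality.Propositional using (Extensionality; lower-extensionality)
open import Data.Bool.Base using (Bool; true; false; T)
open import Data.Empty using (⊥-elim)
open import Data.List.Base using (List; []; _∷_; _++_; foldr; map)
open import Data.List.Relation.Unary.All as All using (All; []; _∷_)
open import Data.List.Relation.Unary.All.Properties using (++⁺; ++⁻; map⁺; map⁻)
open import Data.Product.Base using (_×_; _,_; proj₁; proj₂; ∃; ∃-syntax)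
open import Data.Sum.Base using (_⊎_; inj₁; inj₂; [_,_]′)
open import Level using (Level; suc; _⊔_; 0ℓ; Lift; lift; lower)
open import Relation.Binary.PropositionalEquality using (_≡_; refl; subst)
open import Relation.Nullary.Decidable using (Dec; yes; no; map′; ⌊_⌋; toWitness; fromWitness; decidable-stable)
open import Relation.Nullary.Negation using (¬_; contradiction)
open import Relation.Unary using (Pred; _∈_; _⊆_; _∩_; _∪_; ∁; Satisfiable)
import Relation.Unary.Polymorphic as Polymorphic

open Ultrafilter hiding (Member)

private
  variable
    ℓ i p : Level

-- The Teichmüller-Tukey lemma.

lower-em : ∀ {a} b → ExcludedMiddle (a ⊔ b) → ExcludedMiddle a
lower-em b em {P} = map′ lower lift (em {Lift b P})

T-injective : ∀ b c → (T b → T c) → (T c → T b) → b ≡ c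
T-injective true  true  f g = refl
T-injective true  false f g = ⊥-elim (f _)
T-injective false true  f g = ⊥-elim (g _)
T-injective false false f g = refl

-- Subsets are Bool-valued here: they form a type at the level of X, and extensionality makes
-- mutual inclusion the same as equality, so that a choice depending on a subset is well defined.
module Tukey
  {X : Set ℓ} (em : ExcludedMiddle (ℓ ⊔ p)) (ext : Extensionality ℓ 0ℓ)
  (Admissible : Pred (List X) p)
  where

  private
    em₀ : ExcludedMiddle ℓ
    em₀ = lower-em p em

  Subset : Set ℓ
  Subset = X → Bool

  record _⊑_ (K L : Subset) : Set ℓ where
    constructor incl
    field
      at : ∀ x → T (K x) → T (L x)
  open _⊑_

  ⊑-refl : ∀ {K} → K ⊑ K
  ⊑-refl .at _ k = k

  ⊑-trans : ∀ {K L N} → K ⊑ L → L ⊑ N → K ⊑ N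
  ⊑-trans K⊑L L⊑N .at x k = L⊑N .at x (K⊑L .at x k)

  ⊑-antisym : ∀ {K L} → K ⊑ L → L ⊑ K → K ≡ L
  ⊑-antisym K⊑L L⊑K = ext λ x → T-injective _ _ (K⊑L .at x) (L⊑K .at x)

  AdmissibleSet : Pred Subset (ℓ ⊔ p)
  AdmissibleSet K = ∀ xs → All (λ x → T (K x)) xs → Admissible xs

  insert : X → Subset → Subset
  insert x K y = ⌊ em₀ {y ≡ x ⊎ Lift ℓ (T (K y))} ⌋

  insert-⊑ : ∀ {x K} → K ⊑ insert x K
  insert-⊑ .at _ k = fromWitness (inj₂ (lift k))

  Extendable : Pred Subset (ℓ ⊔ p)
  Extendable K = ∃[ x ] (¬ T (K x) × AdmissibleSet (insert x K))

  extend : (K : Subset) → Dec (Extendable K) → Subset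
  extend K (yes (x , _)) = insert x K
  extend K (no _)        = K

  -- A positive decision of `Extendable K` hands over a point, so `em` acts as a choice function.
  next : Subset → Subset
  next K = extend K em

  next-⊑ : ∀ {K} → K ⊑ next K
  next-⊑ {K} with em {Extendable K}
  ... | yes _ = insert-⊑
  ... | no  _ = ⊑-refl

  ⋃ : (Subset → Bool) → Subset
  ⋃ Q x = ⌊ em₀ {∃[ K ] (T (Q K) × T (K x))} ⌋

  ⊑-⋃ : ∀ {Q K} → T (Q K) → K ⊑ ⋃ Q
  ⊑-⋃ q .at _ k = fromWitness (_ , q , k)

  ⋃-⊑ : ∀ {Q L} → (∀ K → T (Q K) → K ⊑ L) → ⋃ Q ⊑ L
  ⋃-⊑ below .at x u with toWitness u
  ... | K , q , k = below K q .at x k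

  -- The empty union starts the tower. Taking `Q` to be `Bool`-valued keeps `Tower` at level `ℓ`, so
  -- that being in the tower is itself such a `Q`.
  data Tower : Subset → Set ℓ where
    step : ∀ {K} → Tower K → Tower (next K)
    sup  : ∀ Q → (∀ K → T (Q K) → Tower K) → Tower (⋃ Q)

  Extreme : Pred Subset ℓ
  Extreme K = ∀ {L} → Tower L → L ⊑ K → L ≡ K ⊎ next L ⊑ K

  -- Induction on the tower proof for `L`. In a union, either some `N` lies above `next K` or all
  -- lie below `K`.
  extreme⇒comparable : ∀ {K L} → Extreme K → Tower L → L ⊑ K ⊎ next K ⊑ L
  extreme⇒comparable K! (step t) with extreme⇒comparable K! t
  ... | inj₂ K⊑L = inj₂ (⊑-trans K⊑L next-⊑)
  ... | inj₁ L⊑K with K! t L⊑K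
  ...   | inj₁ refl = inj₂ ⊑-refl
  ...   | inj₂ L⊑K′ = inj₁ L⊑K′
  extreme⇒comparable {K} K! (sup Q ts) with em₀ {∃[ N ] (T (Q N) × next K ⊑ N)}
  ... | yes (N , q , K⊑N) = inj₂ (⊑-trans K⊑N (⊑-⋃ q))
  ... | no  ¬above        = inj₁ (⋃-⊑ λ N q →
    [ (λ N⊑K → N⊑K) , (λ K⊑N → contradiction (N , q , K⊑N) ¬above) ]′
      (extreme⇒comparable K! (ts N q)))

  tower⇒extreme : ∀ {K} → Tower K → Extreme K
  tower⇒extreme (step t) u L⊑K with extreme⇒comparable (tower⇒extreme t) u
  ... | inj₂ K⊑L = inj₁ (⊑-antisym L⊑K K⊑L)
  ... | inj₁ L⊑K′ with tower⇒extreme t u L⊑K′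
  ...   | inj₁ refl  = inj₂ ⊑-refl
  ...   | inj₂ L⊑K″ = inj₂ (⊑-trans L⊑K″ next-⊑)
  tower⇒extreme (sup Q ts) {L} u L⊑⋃ with em₀ {∃[ N ] (T (Q N) × ¬ N ⊑ L)}
  ... | no ¬out = inj₁ (⊑-antisym L⊑⋃ (⋃-⊑ λ N q → decidable-stable em₀ λ N⋢L → ¬out (N , q , N⋢L)))
  -- `N` is comparable with `L` but not below it, so `L` lies strictly below `N`, which is extreme
  -- by induction.
  ... | yes (N , q , N⋢L) with extreme⇒comparable (tower⇒extreme (ts N q)) u
  ...   | inj₂ N⊑L = contradiction (⊑-trans next-⊑ N⊑L) N⋢L
  ...   | inj₁ L⊑N with tower⇒extreme (ts N q) u L⊑N
  ...     | inj₁ refl = contradiction ⊑-refl N⋢L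
  ...     | inj₂ L⊑N′ = inj₂ (⊑-trans L⊑N′ (⊑-⋃ q))

  tower-chain : ∀ {K L} → Tower K → Tower L → K ⊑ L ⊎ L ⊑ K
  tower-chain t u with extreme⇒comparable (tower⇒extreme u) t
  ... | inj₁ K⊑L = inj₁ K⊑L
  ... | inj₂ L⊑K = inj₂ (⊑-trans next-⊑ L⊑K)

  -- Finitely many members of a chain have a largest one. The list is nonempty because `Q` may be
  -- empty.
  finite-in-member : ∀ Q → (∀ K → T (Q K) → Tower K) →
    ∀ x xs → All (λ y → T (⋃ Q y)) (x ∷ xs) →
    ∃[ K ] (T (Q K) × All (λ y → T (K y)) (x ∷ xs))
  finite-in-member Q ts x [] (u ∷ []) with toWitness u
  ... | K , q , k = K , q , k ∷ []
  finite-in-member Q ts x (y ∷ ys) (u ∷ us) with toWitness u | finite-in-member Q ts y ys us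
  ... | K , q , k | L , r , ls with tower-chain (ts K q) (ts L r)
  ...   | inj₁ K⊑L = L , r , K⊑L .at x k ∷ ls
  ...   | inj₂ L⊑K = K , q , k ∷ All.map (λ {z} → L⊑K .at z) ls

  next-admissible : ∀ {K} → AdmissibleSet K → AdmissibleSet (next K)
  next-admissible {K} adm with em {Extendable K}
  ... | yes (_ , _ , adm′) = adm′
  ... | no  _              = adm

  tower-admissible : Admissible [] → ∀ {K} → Tower K → AdmissibleSet K
  tower-admissible adm (step t) = next-admissible (tower-admissible adm t)
  tower-admissible adm (sup Q ts) []       _  = adm
  tower-admissible adm (sup Q ts) (x ∷ xs) us with finite-in-member Q ts x xs us
  ... | K , q , ks = tower-admissible adm (ts K q) (x ∷ xs) ks

  fixed⇒maximal : ∀ {K} → next K ⊑ K → ∀ x → AdmissibleSet (insert x K) → T (K x)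
  fixed⇒maximal {K} closed x adm with em {Extendable K}
  ... | yes (y , y∉K , _) = contradiction (closed .at y (fromWitness (inj₁ refl))) y∉K
  ... | no  ¬ext = decidable-stable (lower-em (ℓ ⊔ p) em) λ x∉K → ¬ext (x , x∉K , adm)

  -- The union of the whole tower lies in the tower, hence so does its successor, which it therefore
  -- contains. Only a maximal set has a successor that adds nothing.
  tukey : Admissible [] →
    ∃[ K ] (AdmissibleSet K × (∀ x → AdmissibleSet (insert x K) → T (K x)))
  tukey adm = top , tower-admissible adm top-tower , fixed⇒maximal (⊑-⋃ (fromWitness (step top-tower)))
    where
    tower? : Subset → Bool
    tower? K = ⌊ em₀ {Tower K} ⌋

    top : Subset
    top = ⋃ tower?

    top-tower : Tower top
    top-tower = sup tower? λ _ → toWitness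

-- The ultrafilter lemma.

module _
  {S : Set ℓ} {I : Set i} (em : ExcludedMiddle (ℓ ⊔ i)) (ext : Extensionality ℓ 0ℓ)
  (G : I → Pred S ℓ) (fip : ∀ is → ∃[ s ] All (λ i → s ∈ G i) is)
  where

  private
    em₀ : ExcludedMiddle ℓ
    em₀ = lower-em i em

    -- The finite intersection property relative to the `G i`. With these built in, the tower can
    -- start from the empty family, and a maximal family still contains them.
    Meets : Pred (List (S → Bool)) (ℓ ⊔ i)
    Meets xs = ∀ is → ∃[ s ] (All (λ i → s ∈ G i) is × All (λ x → T (x s)) xs)

    open Tukey em ext Meets

    indicator : Pred S ℓ → S → Bool
    indicator A s = ⌊ em₀ {A s} ⌋

  -- Keeps `with` below from normalising the construction.
  abstract
    ultrafilter-lemma : ∃[ 𝒰 ] (∀ i → G i ∈ Member 𝒰)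
    ultrafilter-lemma with tukey (λ is → proj₁ (fip is) , proj₂ (fip is) , [])
    ... | K , K-meets , K-maximal = 𝒰 , λ i → lift (compatible⇒∈ λ xs ks is → contains i xs ks is)
      where
      In : Pred (S → Bool) 0ℓ
      In x = T (K x)

      remove : ∀ x xs → All (λ y → T (insert x K y)) xs →
        ∃[ ys ] (All In ys × (∀ s → T (x s) → All (λ y → T (y s)) ys → All (λ y → T (y s)) xs))
      remove x []       []       = [] , [] , λ _ _ _ → []
      remove x (y ∷ xs) (u ∷ us) with remove x xs us | toWitness u
      ... | ys , ks , f | inj₁ refl     = ys , ks , λ s xs ys → xs ∷ f s xs ys
      ... | ys , ks , f | inj₂ (lift k) = y ∷ ys , k ∷ ks , λ { s xs (z ∷ zs) → z ∷ f s xs zs }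

      -- Adding `A` keeps the family admissible: `remove` strips `A` from a list and the hypothesis
      -- handles the remainder. Maximality then applies.
      compatible⇒∈ : ∀ {A} →
        (∀ xs → All In xs → ∀ is → ∃[ s ] (s ∈ A × All (λ i → s ∈ G i) is × All (λ x → T (x s)) xs)) →
        In (indicator A)
      compatible⇒∈ {A} compatible = K-maximal (indicator A) λ xs us is →
        let ys , ks , f = remove (indicator A) xs us
            s , a , gs , zs = compatible ys ks is
        in s , gs , f s (fromWitness a) zs

      contains : ∀ i xs → All In xs → ∀ is →
        ∃[ s ] (s ∈ G i × All (λ i → s ∈ G i) is × All (λ x → T (x s)) xs)
      contains i xs ks is with K-meets xs ks (i ∷ is)
      ... | s , g ∷ gs , zs = s , g , gs , zs

      𝒰 : Ultrafilter S
      𝒰 .Ultrafilter.Member A = Lift ℓ (In (indicator A))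
      𝒰 .whole = lift (compatible⇒∈ λ xs ks is →
        let s , gs , zs = K-meets xs ks is in s , _ , gs , zs)
      𝒰 .upward A⊆B (lift a) = lift (compatible⇒∈ λ xs ks is → drop-hits A⊆B (K-meets (_ ∷ xs) (a ∷ ks) is))
        where
        drop-hits : ∀ {A B : Pred S ℓ} {is xs} → A ⊆ B →
          ∃[ s ] (All (λ i → s ∈ G i) is × All (λ x → T (x s)) (indicator A ∷ xs)) →
          ∃[ s ] (s ∈ B × All (λ i → s ∈ G i) is × All (λ x → T (x s)) xs)
        drop-hits A⊆B (s , gs , z ∷ zs) = s , A⊆B (toWitness z) , gs , zs
      𝒰 .∩-closed {A} {B} (lift a) (lift b) = lift (compatible⇒∈ λ xs ks is →
        drop-hits (K-meets (_ ∷ _ ∷ xs) (a ∷ b ∷ ks) is))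
        where
        drop-hits : ∀ {is xs} →
          ∃[ s ] (All (λ i → s ∈ G i) is × All (λ x → T (x s)) (indicator A ∷ indicator B ∷ xs)) →
          ∃[ s ] (s ∈ A ∩ B × All (λ i → s ∈ G i) is × All (λ x → T (x s)) xs)
        drop-hits (s , gs , y ∷ z ∷ zs) = s , (toWitness y , toWitness z) , gs , zs
      𝒰 .proper (lift a) with K-meets (_ ∷ []) (a ∷ []) []
      ... | s , _ , z ∷ [] = s , toWitness z
      -- If a finite intersection avoids `A`, combining it with any other shows that `∁ A` meets
      -- them all; if none does, `A` meets them all.
      𝒰 .ultra A with em {∃[ xs ] (All In xs × ∃[ is ] (∀ s →
                            All (λ i → s ∈ G i) is → All (λ x → T (x s)) xs → s ∈ ∁ A))}
      ... | yes (xs , ks , is , avoid) = inj₂ (lift (compatible⇒∈ λ ys ls js →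
        let s , gs , zs = K-meets (xs ++ ys) (++⁺ ks ls) (is ++ js)
            gs₁ , gs₂ = ++⁻ is gs
            zs₁ , zs₂ = ++⁻ xs zs
        in s , avoid s gs₁ zs₁ , gs₂ , zs₂))
      ... | no ¬avoid = inj₁ (lift (compatible⇒∈ λ xs ks is → decidable-stable em λ ¬s →
        ¬avoid (xs , ks , is , λ s gs zs a → ¬s (s , a , gs , zs))))

-- Elementary facts on ultrafilters.

principal : ExcludedMiddle ℓ → {S : Set ℓ} → S → β S
principal em s .Ultrafilter.Member A = A s
principal em s .whole        = _
principal em s .upward A⊆B   = A⊆B
principal em s .∩-closed a b = a , b
principal em s .proper a     = s , a
principal em s .ultra A with em {A s}
... | yes a = inj₁ a
... | no ¬a = inj₂ ¬a

module _ {S : Set ℓ} (𝒰 : β S) where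

  not-both-∁ : ∀ {A} → A ∈ Member 𝒰 → ∁ A ∈ Member 𝒰 → ∀ {q} {Q : Set q} → Q
  not-both-∁ a ¬a with 𝒰 .proper (𝒰 .∩-closed a ¬a)
  ... | _ , s , ¬s = contradiction s ¬s

  common-element : ∀ {J : Set ℓ} {A : J → Pred S ℓ} {js} →
    All (λ j → A j ∈ Member 𝒰) js → ∃[ s ] All (λ j → s ∈ A j) js
  common-element {A = A} as = 𝒰 .proper (⋂∈ as)
    where
    ⋂∈ : ∀ {js} → All (λ j → A j ∈ Member 𝒰) js → (λ s → All (λ j → s ∈ A j) js) ∈ Member 𝒰
    ⋂∈ []       = 𝒰 .upward (λ _ → []) (𝒰 .whole)
    ⋂∈ (a ∷ as) = 𝒰 .upward (λ (s , ss) → s ∷ ss) (𝒰 .∩-closed a (⋂∈ as))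

-- Products of ultrafilters and upward directedness.

module _ {S : Set ℓ} (_∙_ : S → S → S) where

  Translates : β S → Pred S ℓ → Pred S ℓ
  Translates 𝒱 B s = (λ r → s ∙ r ∈ B) ∈ Member 𝒱

  -- Each `s` in `F` admits `𝒱`-many multipliers, so some multiplier serves all of `F`.
  translates-≤ : ∀ 𝒱 B → Translates 𝒱 B ≤[ 𝓕 _∙_ ] B
  translates-≤ 𝒱 B F = common-element 𝒱

  ∁-translates : ∀ 𝒱 B → ∁ (Translates 𝒱 B) ⊆ Translates 𝒱 (∁ B)
  ∁-translates 𝒱 B {s} ¬b with 𝒱 .ultra (λ r → s ∙ r ∈ B)
  ... | inj₁ b  = contradiction b ¬b
  ... | inj₂ ∁b = ∁b

  -- The usual extension of `_∙_` to the Stone-Čech compactification of the discrete space `S`.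
  product : β S → β S → β S
  product 𝒰 𝒱 .Ultrafilter.Member B = Translates 𝒱 B ∈ Member 𝒰
  product 𝒰 𝒱 .whole = 𝒰 .upward (λ _ → 𝒱 .upward _ (𝒱 .whole)) (𝒰 .whole)
  product 𝒰 𝒱 .upward A⊆B = 𝒰 .upward (𝒱 .upward A⊆B)
  product 𝒰 𝒱 .∩-closed a b = 𝒰 .upward (λ (a , b) → 𝒱 .∩-closed a b) (𝒰 .∩-closed a b)
  product 𝒰 𝒱 .proper a with 𝒰 .proper a
  ... | s , b with 𝒱 .proper b
  ...   | r , c = s ∙ r , c
  product 𝒰 𝒱 .ultra A with 𝒰 .ultra (Translates 𝒱 A)
  ... | inj₁ a  = inj₁ a
  ... | inj₂ ¬a = inj₂ (𝒰 .upward (∁-translates 𝒱 A) ¬a)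

  ≤-product₁ : ∀ 𝒰 𝒱 → 𝒰 ≤β[ 𝓕 _∙_ ] product 𝒰 𝒱
  ≤-product₁ 𝒰 𝒱 B b = Translates 𝒱 B , b , translates-≤ 𝒱 B

  module _ {ε : S} (isCM : IsCommutativeMonoid _≡_ _∙_ ε) where
    open IsCommutativeMonoid isCM using (assoc; comm)

    -- A single `s` shifts the whole set, uniformly in `F`; commutativity moves it to the right.
    ≤-product₂ : ∀ 𝒰 𝒱 → 𝒱 ≤β[ 𝓕 _∙_ ] product 𝒰 𝒱
    ≤-product₂ 𝒰 𝒱 B b with 𝒰 .proper b
    ... | s , c = (λ r → s ∙ r ∈ B) , c , λ F fs → s , All.map (λ {r} → subst B (comm s r)) fs

    ≤-trans : ∀ {A} B C → A ≤[ 𝓕 _∙_ ] B → B ≤[ 𝓕 _∙_ ] C → A ≤[ 𝓕 _∙_ ] C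
    ≤-trans B C A≤B B≤C F fs with A≤B F fs
    ... | r , gs with B≤C (map (_∙ r) F) (map⁺ gs)
    ...   | t , hs = r ∙ t , All.map (λ {s} → subst C (assoc s r t)) (map⁻ hs)

    -- Large sets and the nonemptiness of `M`.

    Large : Pred (Pred S ℓ) (suc ℓ)
    Large B = ∀ 𝒱 → ∃[ A ] (A ∈ Member 𝒱 × A ≤[ 𝓕 _∙_ ] B)

    large-upward : ∀ {B C} → B ⊆ C → Large B → Large C
    large-upward B⊆C large 𝒱 with large 𝒱
    ... | A , a , A≤B = A , a , λ F fs → let r , gs = A≤B F fs in r , All.map B⊆C gs

    large-whole : Large Polymorphic.U
    large-whole 𝒱 = Polymorphic.U , 𝒱 .whole , λ F _ → ε , All.universal (λ _ → _) F

    module _ (em : ExcludedMiddle (suc ℓ)) (ext : Extensionality ℓ 0ℓ) where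

      private
        em₀ : ExcludedMiddle ℓ
        em₀ = lower-em (suc ℓ) em

      -- Every member of the principal ultrafilter at `ε` contains `ε`, which no shift moves into
      -- the empty set.
      ∅-not-large : ¬ Large Polymorphic.∅
      ∅-not-large large with large (principal em₀ ε)
      ... | A , a , A≤∅ with A≤∅ (ε ∷ []) (a ∷ [])
      ...   | _ , () ∷ []

      not-large-witness : ∀ B → ¬ Large B → ∃[ 𝒱 ] (¬ (∃[ A ] (A ∈ Member 𝒱 × A ≤[ 𝓕 _∙_ ] B)))
      not-large-witness B ¬large = decidable-stable em λ ¬∃ → ¬large λ 𝒱 →
        decidable-stable em λ ¬A → ¬∃ (𝒱 , ¬A)

      ≤-∪-split : ∀ 𝒲 {A} B C → A ∈ Member 𝒲 → A ≤[ 𝓕 _∙_ ] (B ∪ C) →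
        ∃[ A′ ] (A′ ∈ Member 𝒲 × (A′ ≤[ 𝓕 _∙_ ] B ⊎ A′ ≤[ 𝓕 _∙_ ] C))
      ≤-∪-split 𝒲 {A} B C a A≤B∪C
        -- The multipliers for finite subsets of `A` are gathered into one ultrafilter `𝒵`; the
        -- finite intersection property required is exactly `A ≤ B ∪ C`.
        with ultrafilter-lemma em₀ ext (λ ((s , _) : ∃ A) r → s ∙ r ∈ B ∪ C) fip
        where
        fip : ∀ (is : List (∃ A)) → ∃[ r ] All (λ (s , _) → s ∙ r ∈ B ∪ C) is
        fip is with A≤B∪C (map proj₁ is) (map⁺ (All.universal proj₂ is))
        ... | r , gs = r , map⁻ gs
      ... | 𝒵 , 𝒵-contains with 𝒲 .ultra (Translates 𝒵 B)
      ...   | inj₁ b  = Translates 𝒵 B , b , inj₁ (translates-≤ 𝒵 B)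
      -- For `s` in `A` outside `Translates 𝒵 B`, `𝒵` contains the multipliers into `B ∪ C` and
      -- those into `∁ B`, hence those into `C`.
      ...   | inj₂ ¬b = Translates 𝒵 C , 𝒲 .upward rest⊆ (𝒲 .∩-closed a ¬b) , inj₂ (translates-≤ 𝒵 C)
        where
        rest⊆ : A ∩ ∁ (Translates 𝒵 B) ⊆ Translates 𝒵 C
        rest⊆ (s∈A , ¬s) = 𝒵 .upward
          (λ { (inj₁ b , ¬b) → contradiction b ¬b ; (inj₂ c , _) → c })
          (𝒵 .∩-closed (𝒵-contains (_ , s∈A)) (∁-translates 𝒵 B ¬s))

      large-partition-regular : ∀ B C → ¬ Large B → ¬ Large C → ¬ Large (B ∪ C)
      large-partition-regular B C ¬B ¬C large with not-large-witness B ¬B | not-large-witness C ¬C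
      ... | 𝒰 , ¬𝒰 | 𝒱 , ¬𝒱 with large (product 𝒰 𝒱)
      ...   | A , a , A≤B∪C with ≤-∪-split (product 𝒰 𝒱) B C a A≤B∪C
      -- As `𝒰` is below the product, some `A″` in `𝒰` is below `A′`; transitivity contradicts the
      -- choice of `𝒰`.
      ...     | A′ , a′ , inj₁ A′≤B = let A″ , a″ , A″≤A′ = ≤-product₁ 𝒰 𝒱 A′ a′ in
        ¬𝒰 (A″ , a″ , ≤-trans A′ B A″≤A′ A′≤B)
      ...     | A′ , a′ , inj₂ A′≤C = let A″ , a″ , A″≤A′ = ≤-product₂ 𝒰 𝒱 A′ a′ in
        ¬𝒱 (A″ , a″ , ≤-trans A′ C A″≤A′ A′≤C)

      private
        -- Indexing by subsets raises the level, which is why `ultrafilter-lemma` lets `I` live at a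
        -- level other than that of `S`.
        NotLarge : Set (suc ℓ)
        NotLarge = ∃[ B ] (¬ Large B)

        ⋃NotLarge : List NotLarge → Pred S ℓ
        ⋃NotLarge = foldr (λ (B , _) → B ∪_) Polymorphic.∅

        ⋃-not-large : ∀ is → ¬ Large (⋃NotLarge is)
        ⋃-not-large []              = ∅-not-large
        ⋃-not-large ((B , ¬B) ∷ is) = large-partition-regular B (⋃NotLarge is) ¬B (⋃-not-large is)

        ∉⋃⇒All : ∀ is {s} → ¬ ⋃NotLarge is s → All (λ (B , _) → s ∈ ∁ B) is
        ∉⋃⇒All []       ¬s = []
        ∉⋃⇒All (_ ∷ is) ¬s = (λ b → ¬s (inj₁ b)) ∷ ∉⋃⇒All is (λ bs → ¬s (inj₂ bs))

        -- Without a common point, the union of the listed sets would be all of `S`, which is large.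
        not-large-fip : ∀ is → ∃[ s ] All (λ (B , _) → s ∈ ∁ B) is
        not-large-fip is = decidable-stable em λ ¬∃ → ⋃-not-large is
          (large-upward (λ {s} _ → decidable-stable em₀ λ ¬s → ¬∃ (s , ∉⋃⇒All is ¬s)) large-whole)

      -- Every member of `𝒰` is large, since otherwise its complement would be a member too; this is
      -- what `M` asks.
      M-nonempty : Satisfiable (M (𝓕 _∙_))
      M-nonempty with ultrafilter-lemma em ext (λ (B , _) → ∁ B) not-large-fip
      ... | 𝒰 , 𝒰-contains = 𝒰 , λ 𝒱 B b → decidable-stable em
        (λ ¬B → not-both-∁ 𝒰 b (𝒰-contains (B , λ large → ¬B (large 𝒱))))

corollary3p12 : (ℓ : Level) (S : Set ℓ) (_∙_ : S → S → S) (ε : S) →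
    IsCommutativeMonoid _≡_ _∙_ ε →
    ((𝒰 𝒱 : β S) → ∃[ 𝒲 ] (𝒰 ≤β[ 𝓕 _∙_ ] 𝒲 × 𝒱 ≤β[ 𝓕 _∙_ ] 𝒲))
    × (ExcludedMiddle (suc ℓ) → Extensionality ℓ ℓ → Satisfiable (M (𝓕 _∙_)))
corollary3p12 ℓ S _∙_ ε isCM =
  (λ 𝒰 𝒱 → product _∙_ 𝒰 𝒱 , ≤-product₁ _∙_ 𝒰 𝒱 , ≤-product₂ _∙_ isCM 𝒰 𝒱) ,
  (λ em ext → M-nonempty _∙_ isCM em (lower-extensionality ℓ ℓ ext))
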